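{- Let $n=\max(|S|,|S'|)$. Then the running time of Algorithm ED-Approx on input $S,S',N$ and the list-decoder $\mathrm{Dec}_{\mathcal C}$ is $$O\left(\frac{n}{N}\cdot T_{\mathrm{Dec}_{\mathcal C}}(N)+\frac{NL}{\varepsilon}\cdot n\log\log n\right).$$
   Context: Setting. Let $\varepsilon>0$ be sufficiently small and let $\mathcal C$ be an insertion-deletion code over alphabet $\Sigma_{\mathcal C}$ with block length $N$ and rate $r$ that is $L$-list decodable from any $N(1-\varepsilon)$ deletions and $N(1-\varepsilon)$ insertions in time $T_{\mathrm{Dec}_{\mathcal C}}(N)$: given a string $y$ of length $N$, the decoder $\mathrm{Dec}_{\mathcal C}(y)$ outputs, in time $T_{\mathrm{Dec}_{\mathcal C}}(N)$, the set (of size at most $L$) of all indices $j$ such that the $j$-th codeword $\mathcal C(j)$ can be turned into $y$ by at most $N(1-\varepsilon)$ deletions and at most $N(1-\varepsilon)$ insertions. Let $I$ be the concatenation $\mathcal C(1)\mathcal C(2)\cdots$ of all $|\Sigma_{\mathcal C}|^{Nr}$ codewords, $m$ an arbitrary string with $|m|=|I|=N|\Sigma_{\mathcal C}|^{Nr}$, and $S$ the string with $S_i=(m_i,I_i)$. $S'$ is a given string over the same product alphabet. $S$ and $S'$ are split into consecutive blocks of length $N$; $S(i)$, $S'(i)$ denote the $i$-th blocks, and $C'_i$ denotes the index component (over $\Sigma_{\mathcal C}$) of $S'(i)$. Algorithm ED-Approx. Let $w=1/\varepsilon$. Start with an empty bipartite graph $G$ whose two parts are the positions of $S$ and the positions of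 $S'$. For each block $S'(i)$, compute $\mathrm{Dec}_{\mathcal C}(C'_i)$; for each $j$ in this list and each (valid) block index $k\in[j-w,j+w]$, connect all pairs of vertices of $G$ corresponding to identical symbols in $S(k)$ and $S'(i)$. Finally, compute and return a largest non-crossing matching of $G$ (a set of edges $(u_{i_1},v_{j_1}),\dots,(u_{i_t},v_{j_t})$ with $i_1<\dots<i_t$ and $j_1<\dots<j_t$), using the Hunt–Szymanski algorithm, which finds a largest non-crossing matching of a bipartite graph with $n$ ordered vertices in each part and $r$ edges in $O((n+r)\log\log n)$ time. Symbol comparisons are unit cost.
   Formalization: The parameter ε is taken to be a positive rational number rather than a positive real number. -}

module Defs where

open import Data.Fin.Base using (Fin; toℕ; fromℕ<; combine)
import Data.Fin.Base as Fin
import Data.Fin.Properties as Fin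
open import Data.Integer.Base using (+_; ∣_∣)
open import Data.List.Base using (List; []; _∷_; _++_; length; upTo; allFin)
import Data.List.Membership.DecPropositional as DecMembership
open import Data.List.Membership.Propositional using (_∈_)
open import Data.List.Relation.Unary.All using (All)
open import Data.List.Relation.Unary.All.Properties using (¬Any⇒All¬)
open import Data.List.Relation.Unary.AllPairs using ([]; _∷_)
open import Data.List.Relation.Unary.Linked using (Linked)
open import Data.List.Relation.Unary.Unique.Propositional using (Unique)
open import Data.Maybe.Base using (Maybe; just; nothing; maybe′)
open import Data.Nat.Base using (ℕ; zero; suc; _+_; _*_; _∸_; _⊔_; _≤_; _<_; pred; NonZero)
open import Data.Nat.DivMod using (_/_)
open import Data.Nat.Logarithm using (⌊log₂_⌋)
open import Data.Nat.Properties using (_≤?_; _<?_)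
open import Data.Product.Base using (∃; ∃-syntax; _×_; _,_; proj₁; proj₂)
import Data.Product.Properties as Product
open import Data.Rational.Base as ℚ using (ℚ; 1ℚ)
import Data.Rational.Properties as ℚ
open import Data.Unit.Base using (⊤; tt)
open import Data.Vec.Base using (Vec; lookup; tabulate; zip; concat; toList)
open import Function.Bundles using (_⇔_)
open import Relation.Binary.Definitions using (DecidableEquality)
open import Relation.Nullary using (yes; no)

fromℕ : ℕ → ℚ
fromℕ n = + n ℚ./ 1

-- ⌊log₂ ⌊log₂ n⌋⌋ is the integer part of log₂ log₂ n, hence within a factor 2
-- of it for n ≥ 4; inside O(·) the two are interchangeable.
loglog : ℕ → ℕ
loglog n = ⌊log₂ ⌊log₂ n ⌋ ⌋

-- Unit-cost RAM: a computation is its result together with the number of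
-- elementary steps performed.  Every elementary step of the algorithm below
-- (loop iteration, reading a symbol, comparing two symbols, creating a vertex,
-- inserting an edge) is charged explicitly by `tick`; plain Agda terms are only
-- used for the index arithmetic of a step that has been charged.
record Timed (A : Set) : Set where
  constructor timed
  field
    value : A
    cost  : ℕ

open Timed public

pure : {A : Set} → A → Timed A
pure x = timed x 0

tick : ℕ → Timed ⊤
tick c = timed tt c

infixl 1 _>>=_ _>>_

_>>=_ : {A B : Set} → Timed A → (A → Timed B) → Timed B
timed x c >>= f = timed (value (f x)) (c + cost (f x))

_>>_ : {A B : Set} → Timed A → Timed B → Timed B
t >> u = t >>= λ _ → u

forEach : {A B : Set} → List A → B → (A → B → Timed B) → Timed B
forEach []       s body = pure s
forEach (x ∷ xs) s body = do
  tick 1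
  s′ ← body x s
  forEach xs s′ body

-- x ⇝⟨ d , i ⟩ y : x can be turned into y by exactly d deletions and
-- i insertions, in any order.
data _⇝⟨_,_⟩_ {A : Set} : List A → ℕ → ℕ → List A → Set where
  done   : ∀ {x} → x ⇝⟨ 0 , 0 ⟩ x
  delete : ∀ u a v {d i y} → (u ++ v) ⇝⟨ d , i ⟩ y → (u ++ a ∷ v) ⇝⟨ suc d , i ⟩ y
  insert : ∀ u a v {d i y} → (u ++ a ∷ v) ⇝⟨ d , i ⟩ y → (u ++ v) ⇝⟨ d , suc i ⟩ y

-- A code with block length N over the alphabet Fin q, given by its encoding
-- map.  The number of codewords K is what is written |Σ|^(N r); the rate r is
-- thereby r = log_q K / N and is not a separate datum.
Code : (q K N : ℕ) → Set
Code q K N = Fin K → Vec (Fin q) N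

Within : {q N : ℕ} → ℚ → Vec (Fin q) N → Vec (Fin q) N → Set
Within {N = N} ε x y = ∃[ d ] ∃[ i ]
  (toList x ⇝⟨ d , i ⟩ toList y) ×
  fromℕ d ℚ.≤ fromℕ N ℚ.* (1ℚ ℚ.- ε) ×
  fromℕ i ℚ.≤ fromℕ N ℚ.* (1ℚ ℚ.- ε)

record ListDecoder {q K N : ℕ} (𝒞 : Code q K N) (ε : ℚ) (L : ℕ) (T : ℕ → ℕ) : Set where
  field
    dec        : Vec (Fin q) N → Timed (List (Fin K))
    dec-unique : ∀ y → Unique (value (dec y))
    dec-spec   : ∀ y j → j ∈ value (dec y) ⇔ Within ε (𝒞 j) y
    dec-size   : ∀ y → length (value (dec y)) ≤ L
    dec-time   : ∀ y → cost (dec y) ≤ T N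

-- S = ((m₁ , I₁) , (m₂ , I₂) , …) where I = 𝒞(1) 𝒞(2) ⋯ 𝒞(K).
indexed : {A : Set} {q K N : ℕ} → Code q K N → Vec A (K * N) → Vec (A × Fin q) (K * N)
indexed 𝒞 m = zip m (concat (tabulate 𝒞))

Edge : ℕ → ℕ → Set
Edge a b = Fin a × Fin b

-- Simple bipartite graphs whose parts are Fin a and Fin b.
record Graph (a b : ℕ) : Set where
  constructor graph
  field
    edges  : List (Edge a b)
    unique : Unique edges

open Graph public

module _ {a b : ℕ} where

  open DecMembership (Product.≡-dec (Fin._≟_ {a}) (Fin._≟_ {b})) using (_∈?_)

  addEdge : Edge a b → Graph a b → Graph a b
  addEdge e g with e ∈? edges g
  ... | yes _  = g
  ... | no e∉g = graph (e ∷ edges g) (¬Any⇒All¬ (edges g) e∉g ∷ unique g)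

  -- A RAM inserts an edge in O(1), using an adjacency table to recognise an
  -- edge that is already present.
  connect : Edge a b → Graph a b → Timed (Graph a b)
  connect e g = do
    tick 1
    pure (addEdge e g)

  createGraph : Timed (Graph a b)
  createGraph = do
    tick (a + b)
    pure (graph [] [])

  _≺_ : Edge a b → Edge a b → Set
  (u , v) ≺ (u′ , v′) = u Fin.< u′ × v Fin.< v′

  NonCrossingMatching : Graph a b → List (Edge a b) → Set
  NonCrossingMatching g M = All (_∈ edges g) M × Linked _≺_ M

  LargestNonCrossingMatching : Graph a b → List (Edge a b) → Set
  LargestNonCrossingMatching g M =
    NonCrossingMatching g M × (∀ M′ → NonCrossingMatching g M′ → length M′ ≤ length M)

-- For parts of different sizes, n is the larger size (the smaller part can be
-- padded with isolated vertices).
record HuntSzymanski : Set where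
  field
    run      : ∀ {a b} → Graph a b → Timed (List (Edge a b))
    run-spec : ∀ {a b} (g : Graph a b) → LargestNonCrossingMatching g (value (run g))
    run-time : ∃[ c ] ∃[ n₀ ] ∀ {a b} (g : Graph a b) → n₀ ≤ a ⊔ b →
               cost (run g) ≤ c * ((a ⊔ b + length (edges g)) * loglog (a ⊔ b))

module EDApprox
  {A : Set} (_≟_ : DecidableEquality A)
  {q K N n′ : ℕ} {{_ : NonZero N}}
  (ε : ℚ) {{_ : ℚ.Positive ε}}
  (pad : Fin q)
  (dec : Vec (Fin q) N → Timed (List (Fin K)))
  (hs : HuntSzymanski)
  (S : Vec (A × Fin q) (K * N)) (S′ : Vec (A × Fin q) n′)
  where

  G : Set
  G = Graph (K * N) n′

  _≟ₛ_ : DecidableEquality (A × Fin q)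
  _≟ₛ_ = Product.≡-dec _≟_ Fin._≟_

  w : ℚ
  w = (ℚ.1/ ε) {{ℚ.pos⇒nonZero ε}}

  ⌊w⌋ : ℕ
  ⌊w⌋ = ∣ ℚ.floor w ∣

  blocks : ℕ
  blocks = (n′ + pred N) / N

  -- The t-th position of S′(i); `nothing` occurs only beyond the end of S′,
  -- when the last block is shorter than N.
  position : ℕ → Fin N → Maybe (Fin n′)
  position i t with i * N + toℕ t <? n′
  ... | yes p = just (fromℕ< p)
  ... | no _  = nothing

  -- C′ᵢ; the decoder expects exactly N symbols, so an incomplete last block is
  -- filled up with the symbol `pad`.
  indexWord : ℕ → Timed (Vec (Fin q) N)
  indexWord i = do
    tick N
    pure (tabulate λ t → maybe′ (λ v → proj₂ (lookup S′ v)) pad (position i t))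

  connectAt : Fin (K * N) → Maybe (Fin n′) → G → Timed G
  connectAt u nothing  g = pure g
  connectAt u (just v) g = do
    tick 1
    compare
    where
    compare : Timed G
    compare with lookup S u ≟ₛ lookup S′ v
    ... | yes _ = connect (u , v) g
    ... | no _  = pure g

  connectBlocks : Fin K → ℕ → G → Timed G
  connectBlocks k i g =
    forEach (allFin N) g λ t g →
    forEach (allFin N) g λ t′ g →
    connectAt (combine k t) (position i t′) g

  -- The o-th of the 2⌊w⌋ + 1 integers in [j - w , j + w], if it is the index of
  -- a block of S.
  neighbour : Fin K → ℕ → Maybe (Fin K)
  neighbour j o with ⌊w⌋ ≤? toℕ j + o | (toℕ j + o) ∸ ⌊w⌋ <? K
  ... | yes _ | yes p = just (fromℕ< p)
  ... | _     | _     = nothing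

  processIndex : ℕ → Fin K → G → Timed G
  processIndex i j g =
    forEach (upTo (2 * ⌊w⌋ + 1)) g λ o g →
    maybe′ (λ k → connectBlocks k i g) (pure g) (neighbour j o)

  processBlock : ℕ → G → Timed G
  processBlock i g = do
    y  ← indexWord i
    js ← dec y
    forEach js g (processIndex i)

  edApprox : Timed (List (Edge (K * N) n′))
  edApprox = do
    tick 1  -- w = 1/ε
    g₀ ← createGraph
    g  ← forEach (upTo blocks) g₀ processBlock
    HuntSzymanski.run hs g

{-# OPTIONS --safe #-}
-- Every vertex of S′ is visited by at most L (2 ⌊1/ε⌋ + 1) blocks of S, hence
-- compared with O(N L / ε) vertices of S.  This bounds both the time for building
-- the graph, apart from the decoding, and its number of edges by O(N L n / ε);
-- the matching contributes the factor log log n.  Since a codeword decodes to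
-- itself and ε ≤ 1, both L and ⌊1/ε⌋ are at least 1, so the linear terms are
-- absorbed.
module Submission where

open import Defs
open import Data.Fin.Base using (Fin; combine)
import Data.Fin.Base as Fin
import Data.Fin.Properties as Fin
open import Data.Integer.Base using (+_; +[1+_]; ∣_∣)
import Data.Integer.Base as ℤ
import Data.Integer.Properties as ℤ
open import Data.List.Base using (List; []; _∷_; length; upTo; allFin)
import Data.List.Membership.DecPropositional as DecMembership
open import Data.List.Membership.Propositional using (_∈_)
open import Data.List.Properties using (length-tabulate; length-upTo)
open import Data.Maybe.Base using (just; nothing; maybe′)
open import Data.Nat.Base using (ℕ; suc; pred; _+_; _*_; _⊔_; _≤_; z≤n; s≤s; NonZero; >-nonZero; >-nonZero⁻¹)
open import Data.Nat.DivMod using (_/_; m/n*n≤m; m≥n⇒m/n>0)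
open import Data.Nat.Coprimality as Coprimality using (Coprime; 1-coprimeTo)
open import Data.Nat.Logarithm using (⌊log₂⌋-mono-≤)
open import Data.Nat.Properties
open import Data.Nat.Tactic.RingSolver using (solve-∀)
open import Data.Product.Base using (_×_; _,_; ∃-syntax)
import Data.Product.Properties as Product
open import Data.Rational.Base as ℚ using (ℚ; 0ℚ; 1ℚ; mkℚ; *≤*)
open import Data.Rational.Properties as ℚₚ using (pos⇒nonZero)
import Data.Rational.Unnormalised.Base as ℚᵘ
import Data.Rational.Unnormalised.Properties as ℚᵘₚ
open import Data.Vec.Base using (Vec; lookup)
open import Function.Bundles using (Equivalence)
open import Relation.Binary.Definitions using (DecidableEquality)
open import Relation.Binary.PropositionalEquality using (_≡_; refl; sym; trans; cong; cong₂; subst; subst₂)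
open import Relation.Nullary using (yes; no)

module _ {a b : ℕ} where

  open DecMembership (Product.≡-dec (Fin._≟_ {a}) (Fin._≟_ {b})) using (_∈?_)

  size : Graph a b → ℕ
  size g = length (edges g)

  record Extends (g : Graph a b) (c e : ℕ) (t : Timed (Graph a b)) : Set where
    constructor extends
    field
      cost≤ : cost t ≤ c
      size≤ : size (value t) ≤ e + size g

  open Extends public

  extends-pure : ∀ {g c e} → Extends g c e (pure g)
  extends-pure {e = e} = extends z≤n (m≤n+m _ e)

  extends-tick : ∀ {g c e t} k → Extends g c e t → Extends g (k + c) e (tick k >> t)
  extends-tick k (extends p q) = extends (+-monoʳ-≤ k p) q

  extends-forEach : ∀ {B : Set} {c e} (xs : List B) {body : B → Graph a b → Timed (Graph a b)} →
                    (∀ x g → Extends g c e (body x g)) → ∀ g →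
                    Extends g (length xs * suc c) (length xs * e) (forEach xs g body)
  extends-forEach [] h g = extends-pure
  extends-forEach {c = c} {e} (x ∷ xs) {body} h g
    with h x g | extends-forEach xs h (value (body x g))
  ... | extends p q | extends p′ q′ = extends (s≤s (+-mono-≤ p p′)) (begin
      _                                ≤⟨ q′ ⟩
      length xs * e + _                ≤⟨ +-monoʳ-≤ (length xs * e) q ⟩
      length xs * e + (e + size g)     ≡⟨ rearrange (length xs * e) e (size g) ⟩
      e + length xs * e + size g       ∎)
    where
    open ≤-Reasoning
    rearrange : ∀ x y z → x + (y + z) ≡ y + x + z
    rearrange = solve-∀

  extends-mono : ∀ {g c c′ e e′ t} → c ≤ c′ → e ≤ e′ → Extends g c e t → Extends g c′ e′ t
  extends-mono {g} c≤c′ e≤e′ (extends p q) =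
    extends (≤-trans p c≤c′) (≤-trans q (+-monoˡ-≤ (size g) e≤e′))

  extends-forEach-≤ : ∀ {B : Set} {c e l} (xs : List B) {body : B → Graph a b → Timed (Graph a b)} →
                      length xs ≤ l → (∀ x g → Extends g c e (body x g)) → ∀ g →
                      Extends g (l * suc c) (l * e) (forEach xs g body)
  extends-forEach-≤ {c = c} {e} xs xs≤l h g =
    extends-mono (*-monoˡ-≤ (suc c) xs≤l) (*-monoˡ-≤ e xs≤l) (extends-forEach xs h g)

  extends-connect : ∀ u g → Extends g 1 1 (connect u g)
  extends-connect u g with u ∈? edges g
  ... | yes _ = extends ≤-refl (n≤1+n _)
  ... | no _  = extends ≤-refl ≤-refl

module _
  {A : Set} (_≟_ : DecidableEquality A)
  {q K N n′ : ℕ} {{_ : NonZero N}}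
  (ε : ℚ) {{_ : ℚ.Positive ε}}
  (pad : Fin q)
  (dec : Vec (Fin q) N → Timed (List (Fin K)))
  (hs : HuntSzymanski)
  (S : Vec (A × Fin q) (K * N)) (S′ : Vec (A × Fin q) n′)
  (L τ : ℕ)
  (dec-size : ∀ y → length (value (dec y)) ≤ L)
  (dec-time : ∀ y → cost (dec y) ≤ τ)
  where

  open EDApprox _≟_ ε pad dec hs S S′

  connectBlocksCost processIndexCost processBlockCost buildCost buildSize : ℕ
  connectBlocksCost = N * suc (N * 3)
  processIndexCost  = (2 * ⌊w⌋ + 1) * suc connectBlocksCost
  processBlockCost  = N + (τ + L * suc processIndexCost)
  buildCost         = blocks * suc processBlockCost
  buildSize         = blocks * (L * ((2 * ⌊w⌋ + 1) * (N * (N * 1))))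

  extends-connectAt : ∀ u v g → Extends g 2 1 (connectAt u v g)
  extends-connectAt u nothing  g = extends-pure
  extends-connectAt u (just v) g with lookup S u ≟ₛ lookup S′ v
  ... | yes _ = extends-tick 1 (extends-connect (u , v) g)
  ... | no _  = extends (s≤s z≤n) (n≤1+n _)

  length-allFin≤ : length (allFin N) ≤ N
  length-allFin≤ = ≤-reflexive (length-tabulate {n = N} (λ i → i))

  extends-connectBlocks : ∀ k i g → Extends g connectBlocksCost (N * (N * 1)) (connectBlocks k i g)
  extends-connectBlocks k i =
    extends-forEach-≤ (allFin N) length-allFin≤ λ t →
    extends-forEach-≤ (allFin N) length-allFin≤ λ t′ →
    extends-connectAt (combine k t) (position i t′)

  extends-processIndex : ∀ i j g →
    Extends g processIndexCost ((2 * ⌊w⌋ + 1) * (N * (N * 1))) (processIndex i j g)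
  extends-processIndex i j =
    extends-forEach-≤ (upTo (2 * ⌊w⌋ + 1)) (≤-reflexive (length-upTo (2 * ⌊w⌋ + 1))) λ o →
    extends-block (neighbour j o)
    where
    extends-block : ∀ k g → Extends g connectBlocksCost (N * (N * 1))
                      (maybe′ (λ k → connectBlocks k i g) (pure g) k)
    extends-block nothing  g = extends-pure
    extends-block (just k) g = extends-connectBlocks k i g

  extends-processBlock : ∀ i g →
    Extends g processBlockCost (L * ((2 * ⌊w⌋ + 1) * (N * (N * 1)))) (processBlock i g)
  extends-processBlock i g
    with extends-forEach-≤ (value (dec (value (indexWord i)))) (dec-size _) (extends-processIndex i) g
  ... | extends p q = extends
    (+-mono-≤ (≤-reflexive (+-identityʳ N)) (+-mono-≤ (dec-time _) p)) q

  cost-edApprox : ∀ c n₀ →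
    (∀ {a b} (g : Graph a b) → n₀ ≤ a ⊔ b →
      cost (HuntSzymanski.run hs g) ≤ c * ((a ⊔ b + size g) * loglog (a ⊔ b))) →
    let n = K * N ⊔ n′ in
    n₀ ≤ n →
    cost edApprox ≤ 1 + (K * N + n′ + (buildCost + c * ((n + buildSize) * loglog n)))
  cost-edApprox c n₀ run-time n₀≤n = s≤s (+-mono-≤ (≤-reflexive (+-identityʳ (K * N + n′))) (+-mono-≤ (cost≤ built)
    (≤-trans (run-time _ n₀≤n)
      (*-monoʳ-≤ c (*-monoˡ-≤ (loglog n) (+-monoʳ-≤ n
        (≤-trans (size≤ built) (≤-reflexive (+-identityʳ buildSize)))))))))
    where
    n : ℕ
    n = K * N ⊔ n′
    built = extends-forEach-≤ (upTo blocks) (≤-reflexive (length-upTo blocks))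
              extends-processBlock (value createGraph)

module _ {N L f n ℓ k n′ B : ℕ} (τ c : ℕ)
  (N≥1 : 1 ≤ N) (L≥1 : 1 ≤ L) (f≥1 : 1 ≤ f) (n≥1 : 1 ≤ n) (ℓ≥1 : 1 ≤ ℓ)
  (k≤n : k ≤ n) (n′≤n : n′ ≤ n) (B*N≤2n : B * N ≤ 2 * n)
  where

  open ≤-Reasoning

  private
    Z Q : ℕ
    Z = N * L * f
    Q = Z * (n * ℓ)

  1≤Z : 1 ≤ Z
  1≤Z = *-mono-≤ (*-mono-≤ N≥1 L≥1) f≥1

  Zn≤Q : Z * n ≤ Q
  Zn≤Q = *-monoʳ-≤ Z (m≤m*n n ℓ {{>-nonZero ℓ≥1}})

  n≤Zn : n ≤ Z * n
  n≤Zn = m≤n*m n Z {{>-nonZero 1≤Z}}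

  n≤Q : n ≤ Q
  n≤Q = ≤-trans n≤Zn Zn≤Q

  2f+1≤3f : 2 * f + 1 ≤ 3 * f
  2f+1≤3f = begin
    2 * f + 1  ≤⟨ +-monoʳ-≤ (2 * f) f≥1 ⟩
    2 * f + f  ≡⟨ lemma f ⟩
    3 * f      ∎
    where
    lemma : ∀ f → 2 * f + f ≡ 3 * f
    lemma = solve-∀

  linearCost≤ : 1 + (k + n′) ≤ 3 * Q
  linearCost≤ = begin
    1 + (k + n′)  ≤⟨ +-mono-≤ n≥1 (+-mono-≤ k≤n n′≤n) ⟩
    n + (n + n)   ≡⟨ lemma n ⟩
    3 * n         ≤⟨ *-monoʳ-≤ 3 n≤Q ⟩
    3 * Q         ∎
    where
    lemma : ∀ n → n + (n + n) ≡ 3 * n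
    lemma = solve-∀

  indexCost≤ : suc ((2 * f + 1) * suc (N * suc (N * 3))) ≤ 16 * (f * (N * N))
  indexCost≤ = begin
    suc ((2 * f + 1) * suc (N * suc (N * 3)))
      ≤⟨ +-mono-≤ 1≤fNN (*-mono-≤ 2f+1≤3f (+-mono-≤ 1≤NN
           (*-monoʳ-≤ N (+-monoˡ-≤ (N * 3) N≥1)))) ⟩
    f * (N * N) + 3 * f * (N * N + N * (N + N * 3))
      ≡⟨ lemma f N ⟩
    16 * (f * (N * N)) ∎
    where
    1≤NN : 1 ≤ N * N
    1≤NN = *-mono-≤ N≥1 N≥1
    1≤fNN : 1 ≤ f * (N * N)
    1≤fNN = *-mono-≤ f≥1 1≤NN
    lemma : ∀ f N → f * (N * N) + 3 * f * (N * N + N * (N + N * 3)) ≡ 16 * (f * (N * N))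
    lemma = solve-∀

  buildCost≤ : B * suc (N + (τ + L * suc ((2 * f + 1) * suc (N * suc (N * 3))))) ≤ B * τ + 36 * Q
  buildCost≤ = begin
    B * suc (N + (τ + L * suc ((2 * f + 1) * suc (N * suc (N * 3)))))
      ≤⟨ *-monoʳ-≤ B (+-mono-≤ N≥1 (+-monoʳ-≤ N (+-monoʳ-≤ τ (*-monoʳ-≤ L indexCost≤)))) ⟩
    B * (N + (N + (τ + L * (16 * (f * (N * N))))))
      ≡⟨ lemma₁ B N τ L f ⟩
    B * τ + (2 * (B * N) + 16 * (Z * (B * N)))
      ≤⟨ +-monoʳ-≤ (B * τ) (+-mono-≤ (*-monoʳ-≤ 2 B*N≤2n) (*-monoʳ-≤ 16 (*-monoʳ-≤ Z B*N≤2n))) ⟩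
    B * τ + (2 * (2 * n) + 16 * (Z * (2 * n)))
      ≡⟨ cong (_+_ (B * τ)) (lemma₂ Z n) ⟩
    B * τ + (4 * n + 32 * (Z * n))
      ≤⟨ +-monoʳ-≤ (B * τ) (+-mono-≤ (*-monoʳ-≤ 4 n≤Q) (*-monoʳ-≤ 32 Zn≤Q)) ⟩
    B * τ + (4 * Q + 32 * Q)
      ≡⟨ cong (_+_ (B * τ)) (lemma₃ Q) ⟩
    B * τ + 36 * Q ∎
    where
    lemma₁ : ∀ B N τ L f → B * (N + (N + (τ + L * (16 * (f * (N * N)))))) ≡
                           B * τ + (2 * (B * N) + 16 * (N * L * f * (B * N)))
    lemma₁ = solve-∀
    lemma₂ : ∀ Z n → 2 * (2 * n) + 16 * (Z * (2 * n)) ≡ 4 * n + 32 * (Z * n)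
    lemma₂ = solve-∀
    lemma₃ : ∀ Q → 4 * Q + 32 * Q ≡ 36 * Q
    lemma₃ = solve-∀

  matchingCost≤ : c * ((n + B * (L * ((2 * f + 1) * (N * (N * 1))))) * ℓ) ≤ 7 * c * Q
  matchingCost≤ = begin
    c * ((n + B * (L * ((2 * f + 1) * (N * (N * 1))))) * ℓ)
      ≤⟨ *-monoʳ-≤ c (*-monoˡ-≤ ℓ (+-mono-≤ n≤Zn
           (*-monoʳ-≤ B (*-monoʳ-≤ L (*-monoˡ-≤ (N * (N * 1)) 2f+1≤3f))))) ⟩
    c * ((Z * n + B * (L * (3 * f * (N * (N * 1))))) * ℓ)
      ≡⟨ lemma₁ c Z n B L f N ℓ ⟩
    c * ((Z * n + 3 * (Z * (B * N))) * ℓ)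
      ≤⟨ *-monoʳ-≤ c (*-monoˡ-≤ ℓ (+-monoʳ-≤ (Z * n) (*-monoʳ-≤ 3 (*-monoʳ-≤ Z B*N≤2n)))) ⟩
    c * ((Z * n + 3 * (Z * (2 * n))) * ℓ)
      ≡⟨ lemma₂ c Z n ℓ ⟩
    7 * c * Q ∎
    where
    lemma₁ : ∀ c z n B L f N ℓ → c * ((z * n + B * (L * (3 * f * (N * (N * 1))))) * ℓ) ≡
                                 c * ((z * n + 3 * (N * L * f * (B * N))) * ℓ)
    lemma₁ = solve-∀
    lemma₂ : ∀ c Z n ℓ → c * ((Z * n + 3 * (Z * (2 * n))) * ℓ) ≡ 7 * c * (Z * (n * ℓ))
    lemma₂ = solve-∀

  totalCost≤ :
    1 + (k + n′ + (B * suc (N + (τ + L * suc ((2 * f + 1) * suc (N * suc (N * 3)))))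
      + c * ((n + B * (L * ((2 * f + 1) * (N * (N * 1))))) * ℓ)))
    ≤ B * τ + (39 + 7 * c) * (N * L * f * (n * ℓ))
  totalCost≤ = begin
    _                                           ≤⟨ +-mono-≤ linearCost≤ (+-mono-≤ buildCost≤ matchingCost≤) ⟩
    3 * Q + (B * τ + 36 * Q + 7 * c * Q)        ≡⟨ lemma (B * τ) Q c ⟩
    B * τ + (39 + 7 * c) * Q                    ∎
    where
    lemma : ∀ b Q c → 3 * Q + (b + 36 * Q + 7 * c * Q) ≡ b + (39 + 7 * c) * Q
    lemma = solve-∀

blocks*N≤2n : ∀ {n n′ N} {{_ : NonZero N}} → n′ ≤ n → N ≤ n → (n′ + pred N) / N * N ≤ 2 * n
blocks*N≤2n {n} {n′} {N} n′≤n N≤n = begin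
  (n′ + pred N) / N * N  ≤⟨ m/n*n≤m (n′ + pred N) N ⟩
  n′ + pred N            ≤⟨ +-mono-≤ n′≤n (≤-trans pred[n]≤n N≤n) ⟩
  n + n                  ≡⟨ cong (_+_ n) (sym (+-identityʳ n)) ⟩
  2 * n                  ∎
  where open ≤-Reasoning

1≤loglog : ∀ {n} → 4 ≤ n → 1 ≤ loglog n
1≤loglog 4≤n = ⌊log₂⌋-mono-≤ (⌊log₂⌋-mono-≤ 4≤n)

ι : ℕ → ℚ
ι n = mkℚ (+ n) 0 (Coprimality.sym (1-coprimeTo n))

fromℕ≡ι : ∀ n → fromℕ n ≡ ι n
fromℕ≡ι n = ℚₚ.normalize-coprime (Coprimality.sym (1-coprimeTo n))

fromℕ-mono-≤ : ∀ {m n} → m ≤ n → fromℕ m ℚ.≤ fromℕ n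
fromℕ-mono-≤ {m} {n} m≤n rewrite fromℕ≡ι m | fromℕ≡ι n =
  *≤* (ℤ.*-monoʳ-≤-nonNeg (+ 1) (ℤ.+≤+ m≤n))

fromℕ-+ : ∀ m n → fromℕ (m + n) ≡ fromℕ m ℚ.+ fromℕ n
fromℕ-+ m n rewrite fromℕ≡ι m | fromℕ≡ι n =
  ℚₚ./-cong (cong₂ ℤ._+_ (sym (ℤ.*-identityʳ (+ m))) (sym (ℤ.*-identityʳ (+ n)))) refl

fromℕ-* : ∀ m n → fromℕ (m * n) ≡ fromℕ m ℚ.* fromℕ n
fromℕ-* m n rewrite fromℕ≡ι m | fromℕ≡ι n = ℚₚ./-cong (ℤ.pos-* m n) refl

fromℕ-nonNeg : ∀ n → ℚ.NonNegative (fromℕ n)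
fromℕ-nonNeg n = ℚₚ.normalize-nonNeg n 1

n/N*N≡n : ∀ n N {{_ : NonZero N}} → (+ n ℚ./ N) ℚ.* fromℕ N ≡ fromℕ n
n/N*N≡n n (suc N) = ℚₚ.toℚᵘ-injective (begin
  ℚ.toℚᵘ ((+ n ℚ./ suc N) ℚ.* fromℕ (suc N))
    ≈⟨ ℚₚ.toℚᵘ-homo-* (+ n ℚ./ suc N) (fromℕ (suc N)) ⟩
  ℚ.toℚᵘ (+ n ℚ./ suc N) ℚᵘ.* ℚ.toℚᵘ (fromℕ (suc N))
    ≈⟨ ℚᵘₚ.*-cong (ℚₚ.toℚᵘ-fromℚᵘ (ℚᵘ.mkℚᵘ (+ n) N)) (ℚₚ.toℚᵘ-fromℚᵘ (ℚᵘ.mkℚᵘ (+ suc N) 0)) ⟩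
  ℚᵘ.mkℚᵘ (+ n) N ℚᵘ.* ℚᵘ.mkℚᵘ (+ suc N) 0
    ≈⟨ ℚᵘ.*≡* (ℤ.*-assoc (+ n) (+ suc N) (+ 1)) ⟩
  ℚᵘ.mkℚᵘ (+ n) 0
    ≈⟨ ℚₚ.toℚᵘ-fromℚᵘ (ℚᵘ.mkℚᵘ (+ n) 0) ⟨
  ℚ.toℚᵘ (fromℕ n) ∎)
  where open ℚᵘₚ.≃-Reasoning

⌊1/_⌋ : (ε : ℚ) {{_ : ℚ.Positive ε}} → ℕ
⌊1/ ε ⌋ = ∣ ℚ.floor ((ℚ.1/ ε) {{pos⇒nonZero ε}}) ∣

⌊1/ε⌋≡ : ∀ {a b} .(p : Coprime (suc a) (suc b)) → ⌊1/ mkℚ +[1+ a ] b p ⌋ ≡ suc b / suc a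
⌊1/ε⌋≡ {a} {b} p = trans (ℤ.abs-* (+ 1) (+ (suc b / suc a))) (*-identityˡ (suc b / suc a))

1≤⌊1/ε⌋ : (ε : ℚ) {{_ : ℚ.Positive ε}} → ε ℚ.≤ 1ℚ → 1 ≤ ⌊1/ ε ⌋
1≤⌊1/ε⌋ (mkℚ +[1+ a ] b p) (*≤* a≤b) rewrite ⌊1/ε⌋≡ p =
  m≥n⇒m/n>0 (ℤ.drop‿+≤+ (subst₂ ℤ._≤_ (ℤ.*-identityʳ +[1+ a ]) (ℤ.*-identityˡ +[1+ b ]) a≤b))

⌊1/ε⌋≤1/ε : (ε : ℚ) {{_ : ℚ.Positive ε}} → fromℕ ⌊1/ ε ⌋ ℚ.≤ (ℚ.1/ ε) {{pos⇒nonZero ε}}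
⌊1/ε⌋≤1/ε (mkℚ +[1+ a ] b p) rewrite ⌊1/ε⌋≡ p | fromℕ≡ι (suc b / suc a) = *≤*
  (subst₂ ℤ._≤_ (ℤ.pos-* (suc b / suc a) (suc a)) (sym (ℤ.*-identityʳ +[1+ b ]))
    (ℤ.+≤+ (m/n*n≤m (suc b) (suc a))))

1≤L : ∀ {q K N L T ε} {𝒞 : Code q K N} → NonZero K → ℚ.Positive ε → ε ℚ.≤ 1ℚ →
      ListDecoder 𝒞 ε L T → 1 ≤ L
1≤L {K = suc _} {N} {ε = ε} {𝒞} _ _ ε≤1 D = ≤-trans (nonEmpty j∈) (dec-size (𝒞 Fin.zero))
  where
  open ListDecoder D
  nonEmpty : ∀ {B : Set} {x : B} {xs} → x ∈ xs → 1 ≤ length xs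
  nonEmpty {xs = _ ∷ _} _ = s≤s z≤n
  0≤1-ε : 0ℚ ℚ.≤ 1ℚ ℚ.- ε
  0≤1-ε = subst (ℚ._≤ 1ℚ ℚ.- ε) (ℚₚ.+-inverseʳ ε) (ℚₚ.+-monoˡ-≤ (ℚ.- ε) ε≤1)
  0≤N[1-ε] : 0ℚ ℚ.≤ fromℕ N ℚ.* (1ℚ ℚ.- ε)
  0≤N[1-ε] = subst (ℚ._≤ fromℕ N ℚ.* (1ℚ ℚ.- ε)) (ℚₚ.*-zeroʳ (fromℕ N))
               (ℚₚ.*-monoˡ-≤-nonNeg (fromℕ N) {{fromℕ-nonNeg N}} 0≤1-ε)
  j∈ : Fin.zero ∈ value (dec (𝒞 Fin.zero))
  j∈ = Equivalence.from (dec-spec _ _) (0 , 0 , done , 0≤N[1-ε] , 0≤N[1-ε])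

rationalBound : ∀ {N n B τ P X C t : ℕ} {{_ : NonZero N}} (f : ℕ) {v : ℚ} →
  t ≤ B * τ + C * (P * f * X) → B * N ≤ C * n → fromℕ f ℚ.≤ v →
  fromℕ t ℚ.≤ fromℕ C ℚ.* ((+ n ℚ./ N) ℚ.* fromℕ τ ℚ.+ fromℕ P ℚ.* v ℚ.* fromℕ X)
rationalBound {N} {n} {B} {τ} {P} {X} {C} {t} f {v} t≤ BN≤Cn f≤v = begin
  fromℕ t
    ≤⟨ fromℕ-mono-≤ t≤ ⟩
  fromℕ (B * τ + C * (P * f * X))
    ≡⟨ fromℕ-+ (B * τ) (C * (P * f * X)) ⟩
  fromℕ (B * τ) ℚ.+ fromℕ (C * (P * f * X))
    ≡⟨ cong₂ ℚ._+_ (fromℕ-* B τ) (trans (fromℕ-* C (P * f * X)) (cong (fromℕ C ℚ.*_)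
         (trans (fromℕ-* (P * f) X) (cong (ℚ._* fromℕ X) (fromℕ-* P f))))) ⟩
  fromℕ B ℚ.* fromℕ τ ℚ.+ fromℕ C ℚ.* (fromℕ P ℚ.* fromℕ f ℚ.* fromℕ X)
    ≤⟨ ℚₚ.+-mono-≤ (ℚₚ.*-monoʳ-≤-nonNeg (fromℕ τ) {{fromℕ-nonNeg τ}} B≤C[n/N])
         (ℚₚ.*-monoˡ-≤-nonNeg (fromℕ C) {{fromℕ-nonNeg C}}
         (ℚₚ.*-monoʳ-≤-nonNeg (fromℕ X) {{fromℕ-nonNeg X}}
         (ℚₚ.*-monoˡ-≤-nonNeg (fromℕ P) {{fromℕ-nonNeg P}} f≤v))) ⟩
  fromℕ C ℚ.* (+ n ℚ./ N) ℚ.* fromℕ τ ℚ.+ fromℕ C ℚ.* (fromℕ P ℚ.* v ℚ.* fromℕ X)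
    ≡⟨ cong (ℚ._+ fromℕ C ℚ.* (fromℕ P ℚ.* v ℚ.* fromℕ X))
         (ℚₚ.*-assoc (fromℕ C) (+ n ℚ./ N) (fromℕ τ)) ⟩
  fromℕ C ℚ.* ((+ n ℚ./ N) ℚ.* fromℕ τ) ℚ.+ fromℕ C ℚ.* (fromℕ P ℚ.* v ℚ.* fromℕ X)
    ≡⟨ ℚₚ.*-distribˡ-+ (fromℕ C) ((+ n ℚ./ N) ℚ.* fromℕ τ) (fromℕ P ℚ.* v ℚ.* fromℕ X) ⟨
  fromℕ C ℚ.* ((+ n ℚ./ N) ℚ.* fromℕ τ ℚ.+ fromℕ P ℚ.* v ℚ.* fromℕ X)  ∎
  where
  open ℚₚ.≤-Reasoning
  B≤C[n/N] : fromℕ B ℚ.≤ fromℕ C ℚ.* (+ n ℚ./ N)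
  B≤C[n/N] = ℚₚ.*-cancelʳ-≤-pos (fromℕ N) {{ℚₚ.normalize-pos N 1}} (begin
    fromℕ B ℚ.* fromℕ N                      ≡⟨ fromℕ-* B N ⟨
    fromℕ (B * N)                            ≤⟨ fromℕ-mono-≤ BN≤Cn ⟩
    fromℕ (C * n)                            ≡⟨ fromℕ-* C n ⟩
    fromℕ C ℚ.* fromℕ n                      ≡⟨ cong (fromℕ C ℚ.*_) (n/N*N≡n n N) ⟨
    fromℕ C ℚ.* ((+ n ℚ./ N) ℚ.* fromℕ N)    ≡⟨ ℚₚ.*-assoc (fromℕ C) (+ n ℚ./ N) (fromℕ N) ⟨
    fromℕ C ℚ.* (+ n ℚ./ N) ℚ.* fromℕ N      ∎)

theorem4p1 : (hs : HuntSzymanski) →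
    ∃[ ε₀ ] 0ℚ ℚ.< ε₀ × (∃[ C ] ∃[ n₀ ]
    (∀ (ε : ℚ) {{_ : ℚ.Positive ε}} → ε ℚ.≤ ε₀ →
    ∀ {q K N : ℕ} {{_ : NonZero K}} {{_ : NonZero N}}
    (𝒞 : Code q K N) (L : ℕ) (T : ℕ → ℕ) (D : ListDecoder 𝒞 ε L T)
    {A : Set} (_≟_ : DecidableEquality A) (pad : Fin q)
    (m : Vec A (K * N)) {n′ : ℕ} (S′ : Vec (A × Fin q) n′) →
    let n = (K * N) ⊔ n′ in
    n₀ ≤ n →
    fromℕ (cost (EDApprox.edApprox _≟_ ε pad (ListDecoder.dec D) hs (indexed 𝒞 m) S′))
    ℚ.≤ fromℕ C ℚ.*
    ((+ n ℚ./ N) ℚ.* fromℕ (T N)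
    ℚ.+ fromℕ (N * L) ℚ.* (ℚ.1/ ε) {{pos⇒nonZero ε}} ℚ.* fromℕ (n * loglog n))))
theorem4p1 hs = 1ℚ , ℚₚ.positive⁻¹ 1ℚ , bound (HuntSzymanski.run-time hs)
  where
  bound : (∃[ c ] ∃[ n₀ ] ∀ {a b} (g : Graph a b) → n₀ ≤ a ⊔ b →
            cost (HuntSzymanski.run hs g) ≤ c * ((a ⊔ b + size g) * loglog (a ⊔ b))) → _
  bound (c , n₀ , run-time) = 39 + 7 * c , n₀ ⊔ 4 ,
    λ ε {{ε>0}} ε≤1 {q} {K} {N} {{K≢0}} {{_}} 𝒞 L T D {_} _≟_ pad m {n′} S′ n₀⊔4≤n →
    let open ListDecoder D
        n       = K * N ⊔ n′
        B       = (n′ + pred N) / N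
        4≤n     = ≤-trans (m≤n⊔m n₀ 4) n₀⊔4≤n
        k≤n     = m≤m⊔n (K * N) n′
        n′≤n    = m≤n⊔m (K * N) n′
        B*N≤2n  = blocks*N≤2n n′≤n (≤-trans (m≤n*m N K) k≤n)
    in rationalBound {N} {n} {B} {T N} {N * L} {n * loglog n} {39 + 7 * c} ⌊1/ ε ⌋
      (≤-trans
        (cost-edApprox _≟_ ε pad dec hs (indexed 𝒞 m) S′ L (T N) dec-size dec-time c n₀ run-time
          (≤-trans (m≤m⊔n n₀ 4) n₀⊔4≤n))
        (totalCost≤ {B = B} (T N) c (>-nonZero⁻¹ N) (1≤L K≢0 ε>0 ε≤1 D) (1≤⌊1/ε⌋ ε ε≤1)
          (≤-trans (s≤s z≤n) 4≤n) (1≤loglog 4≤n) k≤n n′≤n B*N≤2n))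
      (≤-trans B*N≤2n (*-monoˡ-≤ n (m≤m+n 2 (37 + 7 * c))))
      (⌊1/ε⌋≤1/ε ε)
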